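{- Let $p,d\geq 1$, let $t_1<t_2<\cdots<t_p$ be real numbers and let $\epsilon=(\epsilon_{ij})\in\{+1,-1\}^{p\times d}$. Define $C^+_{ij}=(j-1)t_i$ if $\epsilon_{ij}=+1$ and $C^+_{ij}=-\infty$ otherwise, and $C^-_{ij}=(j-1)t_i$ if $\epsilon_{ij}=-1$ and $C^-_{ij}=-\infty$ otherwise. Let \[ \mathcal{K}(\epsilon)=\Big\{x\in(\mathbb{R}\cup\{ -\infty\})^d:\ \max_{1\leq j\leq d}(C^-_{ij}+x_j)\leq\max_{1\leq j\leq d}(C^+_{ij}+x_j)\ \text{for all }1\leq i\leq p\Big\} \] (the tropical polar of the signed cyclic polyhedral cone with sign pattern $\epsilon$). Then the extreme rays of $\mathcal{K}(\epsilon)$ are in one-to-one correspondence with the tropically allowed lattice paths for the sign pattern $\epsilon$.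
   Context: Tropical notions: $\mathbb{R}_{\max}=\mathbb{R}\cup\{ -\infty\}$ with $\oplus=\max$ and $\otimes=+$; $u\oplus v$ is the entrywise max of vectors and $\lambda u=(\lambda+u_j)_j$. For a tropical cone $\mathcal{C}$ (closed under $(u,v)\mapsto\lambda u\oplus\mu v$), a non-($-\infty$) vector $u\in\mathcal{C}$ is an extreme generator if $u=v\oplus w$ with $v,w\in\mathcal{C}$ implies $u=v$ or $u=w$; an extreme ray is the set of tropical scalar multiples $\{\lambda u\}$ of an extreme generator. Lattice paths: a lattice path in the $p\times d$ grid is specified by an integer $k\geq 0$ and indices $1\leq i_1<\cdots<i_k\leq p$, $1\leq j_1<\cdots<j_{k+1}\leq d$; it is the sequence of positions $(1,j_1),\ldots,(i_1,j_1),\ldots,(i_1,j_2),\ldots,(i_2,j_2),\ldots,(i_k,j_{k+1}),\ldots,(p,j_{k+1})$, moving alternately down a column and right along a row. Its horizontal segments are, for $1\leq r\leq k$, row $i_r$ from column $j_r$ (leftmost position) to column $j_{r+1}$ (rightmost position). Its vertical segments are: the initial one (column $j_1$, rows $1$ to $i_1$), the intermediate ones (column $j_r$, rows $i_{r-1}$ to $i_r$, $2\leq r\leq k$), and the final one (column $j_{k+1}$, rows $i_k$ to $p$); when $k=0$ there is a single vertical segment, column $j_1$, rows $1$ to $p$. The path is allowed for $\epsilon$ if: (C1) if $k\geq1$, $\epsilon_{ij_1}=+1$ for all $1\leq i<i_1$; (C2) if $k\geq1$, $\epsilon_{ij_{k+1}}=+1$ for all $i_k<i\leq p$, and if $k=0$,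 $\epsilon_{ij_1}=+1$ for all $1\leq i\leq p$; (C3) for $2\leq r\leq k$, $\epsilon_{ij_r}=+1$ for all $i_{r-1}<i<i_r$; (C4) for each $1\leq r\leq k$, $(\epsilon_{i_rj_r},\epsilon_{i_rj_{r+1}})$ is $(+1,-1)$ or $(-1,+1)$. It is tropically allowed if moreover (C5) whenever $(\epsilon_{i_rj_r},\epsilon_{i_rj_{r+1}})=(-1,+1)$ for some $r$, also $(\epsilon_{i_sj_s},\epsilon_{i_sj_{s+1}})=(-1,+1)$ for all $r\leq s\leq k$. -}

module Defs where

open import Level using (0ℓ)
open import Data.Nat as ℕ using (ℕ; zero; suc)
open import Data.Fin as Fin using (Fin; toℕ; inject₁; fromℕ)
open import Data.Vec using (Vec; lookup; toList)
open import Data.List using (List)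
open import Data.Product using (Σ; ∃; _×_; _,_)
open import Data.Sum using (_⊎_)
open import Data.Unit using (⊤)
open import Relation.Nullary using (¬_; Dec; yes; no)
open import Relation.Binary using (IsTotalOrder)
open import Relation.Binary.PropositionalEquality using (_≡_; _≢_)
open import Algebra.Structures using (IsCommutativeRing)

-- The real numbers, axiomatised as a complete ordered field
-- (any model is isomorphic to ℝ).  The order is assumed decidable,
-- as it is for the classical reals.

record RealField : Set₁ where
  infixl 6 _+_
  infixl 7 _*_
  infix 4 _≤_
  field
    Carrier : Set
    _+_ _*_ : Carrier → Carrier → Carrier
    -_      : Carrier → Carrier
    0# 1#   : Carrier
    _≤_     : Carrier → Carrier → Set
    isCommutativeRing : IsCommutativeRing _≡_ _+_ _*_ -_ 0# 1#
    0≢1     : 0# ≢ 1#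
    inverse : ∀ x → x ≢ 0# → ∃ λ y → x * y ≡ 1#
    isTotalOrder : IsTotalOrder _≡_ _≤_
    _≤?_    : ∀ x y → Dec (x ≤ y)
    +-mono-≤ : ∀ {x y} z → x ≤ y → x + z ≤ y + z
    *-nonneg : ∀ {x y} → 0# ≤ x → 0# ≤ y → 0# ≤ x * y
    lub : (S : Carrier → Set) → (∃ λ x → S x) →
          (∃ λ b → ∀ x → S x → x ≤ b) →
          ∃ λ s → (∀ x → S x → x ≤ s) × (∀ b → (∀ x → S x → x ≤ b) → s ≤ b)

  _<_ : Carrier → Carrier → Set
  x < y = x ≤ y × x ≢ y

data Sign : Set where
  plus minus : Sign

-- Lattice paths in the p × d grid (0-based indices).
-- k horizontal steps; rows I₀ < … < I_{k-1}; columns J₀ < … < J_k.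

record LatticePath (p d : ℕ) : Set where
  field
    k    : ℕ
    I    : Vec (Fin p) k
    J    : Vec (Fin d) (suc k)
    I-inc : ∀ (a b : Fin k) → a Fin.< b → lookup I a Fin.< lookup I b
    J-inc : ∀ (a b : Fin (suc k)) → a Fin.< b → lookup J a Fin.< lookup J b

SamePath : ∀ {p d} → LatticePath p d → LatticePath p d → Set
SamePath P Q = toList (LatticePath.I P) ≡ toList (LatticePath.I Q)
             × toList (LatticePath.J P) ≡ toList (LatticePath.J Q)

module _ {p d : ℕ} (ε : Fin p → Fin d → Sign) (P : LatticePath p d) where
  open LatticePath P

  -- (C1) initial vertical segment (only when k ≥ 1)
  C1 : Set
  C1 with k | I | J
  ... | zero  | _ | _  = ⊤
  ... | suc m | I' | J' = ∀ (i : Fin p) → toℕ i ℕ.< toℕ (lookup I' Fin.zero) →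
                          ε i (lookup J' Fin.zero) ≡ plus

  -- (C2) final vertical segment
  C2 : Set
  C2 with k | I | J
  ... | zero  | _ | J'  = ∀ (i : Fin p) → ε i (lookup J' Fin.zero) ≡ plus
  ... | suc m | I' | J' = ∀ (i : Fin p) → toℕ (lookup I' (fromℕ m)) ℕ.< toℕ i →
                          ε i (lookup J' (fromℕ (suc m))) ≡ plus

  -- (C3) intermediate vertical segments: between rows I_a and I_b
  -- (b = a+1) in column J_b
  C3 : Set
  C3 = ∀ (a b : Fin k) → toℕ b ≡ suc (toℕ a) → ∀ (i : Fin p) →
       lookup I a Fin.< i → i Fin.< lookup I b → ε i (lookup J (inject₁ b)) ≡ plus

  horiz : Fin k → Sign × Sign
  horiz r = ε (lookup I r) (lookup J (inject₁ r)) , ε (lookup I r) (lookup J (Fin.suc r))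

  C4 : Set
  C4 = ∀ (r : Fin k) → horiz r ≡ (plus , minus) ⊎ horiz r ≡ (minus , plus)

  C5 : Set
  C5 = ∀ (r s : Fin k) → horiz r ≡ (minus , plus) → toℕ r ℕ.≤ toℕ s →
       horiz s ≡ (minus , plus)

  Allowed : Set
  Allowed = C1 × C2 × C3 × C4

  TropicallyAllowed : Set
  TropicallyAllowed = Allowed × C5

TAPath : ∀ {p d} → (Fin p → Fin d → Sign) → Set
TAPath {p} {d} ε = Σ (LatticePath p d) (TropicallyAllowed ε)

module Tropical (ℝ : RealField) where
  open RealField ℝ public

  data Rmax : Set where
    -∞  : Rmax
    fin : Carrier → Rmax

  infix 4 _≤ₘ_
  data _≤ₘ_ : Rmax → Rmax → Set where
    -∞≤   : ∀ {x} → -∞ ≤ₘ x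
    fin≤  : ∀ {a b} → a ≤ b → fin a ≤ₘ fin b

  _⊕_ : Rmax → Rmax → Rmax
  -∞    ⊕ y     = y
  fin a ⊕ -∞    = fin a
  fin a ⊕ fin b with a ≤? b
  ... | yes _ = fin b
  ... | no  _ = fin a

  _⊗_ : Rmax → Rmax → Rmax
  -∞    ⊗ _     = -∞
  fin _ ⊗ -∞    = -∞
  fin a ⊗ fin b = fin (a + b)

  maxF : ∀ {n} → (Fin n → Rmax) → Rmax
  maxF {zero}  f = -∞
  maxF {suc n} f = f Fin.zero ⊕ maxF (λ j → f (Fin.suc j))

  _·_ : ℕ → Carrier → Carrier
  zero  · x = 0#
  suc n · x = x + n · x

  module _ {p d : ℕ} (t : Fin p → Carrier) (ε : Fin p → Fin d → Sign) where
    -- C⁺_{ij} = (j-1) t_i (1-based j), i.e. toℕ j · t i (0-based j)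
    C⁺ : Fin p → Fin d → Rmax
    C⁺ i j with ε i j
    ... | plus  = fin (toℕ j · t i)
    ... | minus = -∞

    C⁻ : Fin p → Fin d → Rmax
    C⁻ i j with ε i j
    ... | plus  = -∞
    ... | minus = fin (toℕ j · t i)

    K : (Fin d → Rmax) → Set
    K x = ∀ (i : Fin p) → maxF (λ j → C⁻ i j ⊗ x j) ≤ₘ maxF (λ j → C⁺ i j ⊗ x j)

    ExtremeGenerator : (Fin d → Rmax) → Set
    ExtremeGenerator u =
      K u × (∃ λ (j : Fin d) → u j ≢ -∞) ×
      (∀ (v w : Fin d → Rmax) → K v → K w → (∀ j → u j ≡ v j ⊕ w j) →
         (∀ j → u j ≡ v j) ⊎ (∀ j → u j ≡ w j))

  SameRay : ∀ {d} → (Fin d → Rmax) → (Fin d → Rmax) → Set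
  SameRay u v = ∃ λ (l : Carrier) → ∀ j → v j ≡ fin l ⊗ u j

  StrictlyIncreasing : ∀ {p} → (Fin p → Carrier) → Set
  StrictlyIncreasing t = ∀ (a b : Fin _) → a Fin.< b → t a < t b

{-# OPTIONS --safe #-}
module Submission where

-- Call column j top in row i if it attains the maximum of j · t i + x j; the top columns move right as i
-- grows.  A vector is attached to a path by taking the columns of the path as its support and balancing
-- the two ends of every horizontal segment; it is determined up to scaling.
-- Such a vector is extreme because, by (C5), the constraints on the horizontal segments propagate from one
-- pivot column and prevent any other coordinate from decreasing.
-- Conversely, if x is extreme, at most one support column c can be lowered within K(ε), since x is the maximum
-- of any two such lowerings.  Every other support column l has a row in which it is the only top column
-- of sign plus, tied with a partner of sign minus.  These rows increase with l, which forces the partner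
-- to be the neighbour of l on the side of c, so the rows and columns form a tropically allowed path.

open import Defs
open import Data.Nat as ℕ using (ℕ; zero; suc; z≤n; s≤s)
import Data.Nat.Properties as ℕₚ
open import Data.Fin as Fin using (Fin; zero; suc; toℕ; inject₁; fromℕ)
import Data.Fin.Properties as Finₚ
open import Data.Fin.Induction using (<-wellFounded; >-wellFounded; <-weakInduction)
open import Data.Fin.Relation.Unary.Top using (view; ‵fromℕ; ‵inject₁)
open import Data.Product using (Σ; ∃; _×_; _,_; proj₁; proj₂)
open import Data.Sum as Sum using (_⊎_; inj₁; inj₂; [_,_]′)
open import Data.List as List using ()
open import Data.Vec using (Vec; []; _∷_; lookup; map; toList)
open import Data.Vec.Properties using (lookup-map)
open import Function using (_∘_; id)
open import Induction.WellFounded using (Acc; acc)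
open import Relation.Binary using (IsTotalOrder; tri<; tri≈; tri>)
open import Relation.Binary.PropositionalEquality
  using (_≡_; _≢_; refl; sym; trans; cong; cong₂; subst; subst₂; ≢-sym; module ≡-Reasoning)
open import Relation.Nullary using (¬_; Dec; yes; no; contradiction)
open import Relation.Nullary.Decidable using (map′; ¬?; _×-dec_; _→-dec_; decidable-stable)
open import Algebra.Bundles using (CommutativeMonoid)
open import Algebra.Structures using (IsCommutativeRing)
import Algebra.Properties.CommutativeSemigroup as CommutativeSemigroupProperties

-- Increasing maps and finite chains of indices.

private
  variable
    m n o : ℕ

Increasing : (Fin m → Fin n) → Set
Increasing f = ∀ a b → a Fin.< b → f a Fin.< f b

module _ {f : Fin m → Fin n} (f-inc : Increasing f) where

  increasing-mono-≤ : ∀ {a b} → a Fin.≤ b → f a Fin.≤ f b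
  increasing-mono-≤ {a} {b} a≤b with Finₚ.<-cmp a b
  ... | tri< a<b _ _ = ℕₚ.<⇒≤ (f-inc a b a<b)
  ... | tri≈ _ refl _ = ℕₚ.≤-refl
  ... | tri> _ _ b<a = contradiction a≤b (ℕₚ.<⇒≱ b<a)

  increasing-cancel-< : ∀ {a b} → f a Fin.< f b → a Fin.< b
  increasing-cancel-< {a} {b} fa<fb with a Fin.<? b
  ... | yes a<b = a<b
  ... | no a≮b = contradiction (increasing-mono-≤ (ℕₚ.≮⇒≥ a≮b)) (ℕₚ.<⇒≱ fa<fb)

  increasing-injective : ∀ {a b} → f a ≡ f b → a ≡ b
  increasing-injective {a} {b} eq with Finₚ.<-cmp a b
  ... | tri< a<b _ _ = contradiction (cong toℕ eq) (ℕₚ.<⇒≢ (f-inc a b a<b))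
  ... | tri≈ _ a≡b _ = a≡b
  ... | tri> _ _ b<a = contradiction (cong toℕ (sym eq)) (ℕₚ.<⇒≢ (f-inc b a b<a))

increasing-expansive : {f : Fin m → Fin n} → Increasing f → ∀ r → toℕ r ℕ.≤ toℕ (f r)
increasing-expansive {m = suc _} {f = f} f-inc =
  <-weakInduction (λ r → toℕ r ℕ.≤ toℕ (f r)) z≤n
    λ s s≤fs → ℕₚ.≤-<-trans (subst (ℕ._≤ toℕ (f (inject₁ s))) (Finₚ.toℕ-inject₁ s) s≤fs)
                            (f-inc (inject₁ s) (suc s) (s≤s (ℕₚ.≤-reflexive (Finₚ.toℕ-inject₁ s))))

module _ {f : Fin m → Fin o} {g : Fin n → Fin o} (f-inc : Increasing f) (g-inc : Increasing g)
         (σ : ∀ r → ∃ λ s → g s ≡ f r) where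

  reindexing-increasing : Increasing (proj₁ ∘ σ)
  reindexing-increasing a b a<b = increasing-cancel-< g-inc
    (subst₂ Fin._<_ (sym (proj₂ (σ a))) (sym (proj₂ (σ b))) (f-inc a b a<b))

  range-⊆⇒≤ : m ℕ.≤ n
  range-⊆⇒≤ = Finₚ.injective⇒≤ (increasing-injective reindexing-increasing)

-- The reindexing is an increasing self-map, hence expansive. Used in both directions, this
-- identifies two increasing enumerations of one set.
range-⊆⇒≥ : {f g : Fin n → Fin o} → Increasing f → Increasing g →
            (∀ r → ∃ λ s → g s ≡ f r) → ∀ r → g r Fin.≤ f r
range-⊆⇒≥ f-inc g-inc σ r = subst (_ Fin.≤_) (proj₂ (σ r))
  (increasing-mono-≤ g-inc (increasing-expansive (reindexing-increasing f-inc g-inc σ) r))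

lookup-ext : (xs ys : Vec (Fin o) n) → (∀ r → lookup xs r ≡ lookup ys r) → toList xs ≡ toList ys
lookup-ext [] [] _ = refl
lookup-ext (x ∷ xs) (y ∷ ys) eq = cong₂ List._∷_ (eq zero) (lookup-ext xs ys (eq ∘ suc))

choose : ∀ {A : Set} {Q : Fin n → A → Set} → (∀ r → ∃ (Q r)) → Σ (Vec A n) λ v → ∀ r → Q r (lookup v r)
choose {n = zero} _ = [] , λ ()
choose {n = suc _} q with choose (q ∘ suc)
... | v , qv = proj₁ (q zero) ∷ v , λ { zero → proj₂ (q zero) ; (suc r) → qv r }

enumerate : {S : Fin n → Set} → (∀ j → Dec (S j)) →
            ∃ λ o → Σ (Vec (Fin n) o) λ J →
            Increasing (lookup J) × (∀ r → S (lookup J r)) × (∀ j → S j → ∃ λ r → lookup J r ≡ j)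
enumerate {n = zero} _ = 0 , [] , (λ ()) , (λ ()) , λ ()
enumerate {n = suc _} {S} S? with enumerate (S? ∘ suc)
... | o , J , inc , sound , complete = extend (S? zero)
  where
  J⁺ : Vec (Fin _) o
  J⁺ = map suc J

  inc⁺ : Increasing (lookup J⁺)
  inc⁺ a b a<b rewrite lookup-map a Fin.suc J | lookup-map b Fin.suc J = s≤s (inc a b a<b)

  sound⁺ : ∀ r → S (lookup J⁺ r)
  sound⁺ r = subst S (sym (lookup-map r suc J)) (sound r)

  complete⁺ : ∀ j → S (suc j) → ∃ λ r → lookup J⁺ r ≡ suc j
  complete⁺ j s with complete j s
  ... | r , eq = r , trans (lookup-map r suc J) (cong suc eq)

  0<J⁺ : ∀ r → 0 ℕ.< toℕ (lookup J⁺ r)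
  0<J⁺ r rewrite lookup-map r Fin.suc J = s≤s z≤n

  extend : Dec (S zero) → _
  extend (yes s₀) = suc o , zero ∷ J⁺
    , (λ { zero zero () ; zero (suc b) _ → 0<J⁺ b ; (suc a) (suc b) (s≤s a<b) → inc⁺ a b a<b })
    , (λ { zero → s₀ ; (suc r) → sound⁺ r })
    , (λ { zero _ → zero , refl
         ; (suc j) s → suc (proj₁ (complete⁺ j s)) , proj₂ (complete⁺ j s) })
  extend (no ¬s₀) = o , J⁺ , inc⁺ , sound⁺
    , (λ { zero s₀ → contradiction s₀ ¬s₀ ; (suc j) s → complete⁺ j s })

-- Since `B` is upward closed, `m` can be the first index where the given alternative is `B`;
-- `m = o` says that there is none.
threshold : {A B : Fin o → Set} → (∀ s → A s ⊎ B s) → (∀ r s → B r → r Fin.≤ s → B s) →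
            ∃ λ (m : Fin (suc o)) → (∀ s → toℕ s ℕ.< toℕ m → A s) × (∀ s → toℕ m ℕ.≤ toℕ s → B s)
threshold {o = zero} _ _ = zero , (λ ()) , λ ()
threshold {o = suc _} A⊎B up with A⊎B zero
... | inj₂ b = zero , (λ _ ()) , λ s _ → up zero s b z≤n
... | inj₁ a with threshold (A⊎B ∘ suc) (λ r s b r≤s → up (suc r) (suc s) b (s≤s r≤s))
...   | m , below , above = suc m
  , (λ { zero _ → a ; (suc s) (s≤s s<m) → below s s<m })
  , (λ { (suc s) (s≤s m≤s) → above s m≤s })

-- Index `s` is an edge between the nodes `inject₁ s` and `suc s`; `E` travels outward from node
-- `m`, upwards along the edges from `m` on and downwards along those before.
spread : (E : Fin (suc o) → Set) (m : Fin (suc o)) → E m →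
         (∀ s → toℕ m ℕ.≤ toℕ s → E (inject₁ s) → E (suc s)) →
         (∀ s → toℕ s ℕ.< toℕ m → E (suc s) → E (inject₁ s)) →
         ∀ r → E r
spread {o = zero} E zero e _ _ zero = e
spread {o = suc _} E zero e _ _ zero = e
spread {o = suc _} E zero e up _ (suc r) =
  spread (E ∘ suc) zero (up zero z≤n e) (λ s _ → up (suc s) z≤n) (λ _ ()) r
spread {o = suc _} E (suc m) e up down zero = down zero (s≤s z≤n)
  (spread (E ∘ suc) m e (λ s m≤s → up (suc s) (s≤s m≤s)) (λ s s<m → down (suc s) (s≤s s<m)) zero)
spread {o = suc _} E (suc m) e up down (suc r) =
  spread (E ∘ suc) m e (λ s m≤s → up (suc s) (s≤s m≤s)) (λ s s<m → down (suc s) (s≤s s<m)) r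

<⇒inject₁ : (s : Fin (suc o)) → toℕ s ℕ.< m → m ℕ.≤ o → ∃ λ q → s ≡ inject₁ q × toℕ q ℕ.< m
<⇒inject₁ zero s<m (s≤s _) = zero , refl , s<m
<⇒inject₁ (suc s) (s≤s s<m) (s≤s m≤o) with <⇒inject₁ s s<m m≤o
... | q , eq , q<m = suc q , cong suc eq , s≤s q<m

inject₁<suc : (r : Fin o) → inject₁ r Fin.< suc r
inject₁<suc r = s≤s (ℕₚ.≤-reflexive (Finₚ.toℕ-inject₁ r))

plus≢minus : ∀ {s} → s ≡ plus → s ≢ minus
plus≢minus refl ()

_≟ₛ_ : (s s′ : Sign) → Dec (s ≡ s′)
plus ≟ₛ plus = yes refl
plus ≟ₛ minus = no λ ()
minus ≟ₛ plus = no λ ()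
minus ≟ₛ minus = yes refl

-- Arithmetic of the ordered field and of `Rmax`.

module OrderedGroup (ℝ : RealField) where
  open Tropical ℝ
  open IsCommutativeRing isCommutativeRing
    using (+-assoc; +-comm; +-identityˡ; +-identityʳ; -‿inverseʳ; +-isCommutativeMonoid)
    public
  open IsTotalOrder isTotalOrder
    using () renaming (refl to ≤-refl; trans to ≤-trans; antisym to ≤-antisym; total to ≤-total)
    public

  +-commutativeMonoid : CommutativeMonoid _ _
  +-commutativeMonoid = record { isCommutativeMonoid = +-isCommutativeMonoid }

  open CommutativeSemigroupProperties (CommutativeMonoid.commutativeSemigroup +-commutativeMonoid)
    using (interchange)

  x+z-z≡x : ∀ x z → x + z + - z ≡ x
  x+z-z≡x x z = trans (+-assoc x z (- z)) (trans (cong (x +_) (-‿inverseʳ z)) (+-identityʳ x))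

  x-z+z≡x : ∀ x z → x + - z + z ≡ x
  x-z+z≡x x z = trans (+-assoc x (- z) z)
    (trans (cong (x +_) (trans (+-comm (- z) z) (-‿inverseʳ z))) (+-identityʳ x))

  +-cancelʳ-≤ : ∀ {x y} z → x + z ≤ y + z → x ≤ y
  +-cancelʳ-≤ z h = subst₂ _≤_ (x+z-z≡x _ z) (x+z-z≡x _ z) (+-mono-≤ (- z) h)

  +-monoʳ-≤ : ∀ {x y} z → x ≤ y → z + x ≤ z + y
  +-monoʳ-≤ z h = subst₂ _≤_ (+-comm _ z) (+-comm _ z) (+-mono-≤ z h)

  +-cancelˡ-≤ : ∀ {x y} z → z + x ≤ z + y → x ≤ y
  +-cancelˡ-≤ z h = +-cancelʳ-≤ z (subst₂ _≤_ (+-comm z _) (+-comm z _) h)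

  +-mono₂-≤ : ∀ {x y z w} → x ≤ y → z ≤ w → x + z ≤ y + w
  +-mono₂-≤ x≤y z≤w = ≤-trans (+-mono-≤ _ x≤y) (+-monoʳ-≤ _ z≤w)

  ·-mono-≤ : ∀ n {s t} → s ≤ t → n · s ≤ n · t
  ·-mono-≤ zero _ = ≤-refl
  ·-mono-≤ (suc n) s≤t = +-mono₂-≤ s≤t (·-mono-≤ n s≤t)

  -- This is `(b - a)(t - s) ≥ 0` for natural multiples; the recursion removes `t + s` from both
  -- sides.
  cross : ∀ {a b s t} → a ℕ.≤ b → s ≤ t → a · t + b · s ≤ b · t + a · s
  cross {b = b} z≤n s≤t =
    subst₂ _≤_ (sym (+-identityˡ _)) (sym (+-identityʳ _)) (·-mono-≤ b s≤t)
  cross {s = s} {t} (s≤s {a} {b} a≤b) s≤t =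
    subst₂ _≤_ (interchange t s (a · t) (b · s)) (interchange t s (b · t) (a · s))
      (+-monoʳ-≤ (t + s) (cross a≤b s≤t))

  cross-strict : ∀ {a b s t} → a ℕ.< b → s < t → ¬ (b · t + a · s ≤ a · t + b · s)
  -- Here `h` says `t + b · t ≤ s + b · s`, and the right side is at most `s + b · t`; cancelling
  -- `b · t` gives `t ≤ s`.
  cross-strict {zero} {suc b} {s} {t} _ (s≤t , s≢t) h = s≢t (≤-antisym s≤t
    (+-cancelʳ-≤ (b · t) (≤-trans (subst₂ _≤_ (+-identityʳ _) (+-identityˡ _) h)
                                 (+-monoʳ-≤ s (·-mono-≤ b s≤t)))))
  cross-strict {suc a} {suc b} {s} {t} (s≤s a<b) s<t h = cross-strict a<b s<t
    (+-cancelˡ-≤ (t + s)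
      (subst₂ _≤_ (interchange t (b · t) s (a · s)) (interchange t (a · t) s (b · s)) h))

  exchange : ∀ {a b s t} x y → a ℕ.≤ b → s ≤ t →
             (a · t + x) + (b · s + y) ≤ (b · t + y) + (a · s + x)
  exchange {a} {b} {s} {t} x y a≤b s≤t = subst₂ _≤_
    (interchange (a · t) (b · s) x y)
    (trans (cong ((b · t + a · s) +_) (+-comm x y)) (interchange (b · t) (a · s) y x))
    (+-mono-≤ (x + y) (cross a≤b s≤t))

  exchange-strict : ∀ {a b s t} x y → a ℕ.< b → s < t →
                    ¬ ((b · t + y) + (a · s + x) ≤ (a · t + x) + (b · s + y))
  exchange-strict {a} {b} {s} {t} x y a<b s<t h = cross-strict a<b s<t (+-cancelʳ-≤ (x + y) (subst₂ _≤_
    (trans (interchange (b · t) y (a · s) x) (cong ((b · t + a · s) +_) (+-comm y x)))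
    (interchange (a · t) x (b · s) y) h))

  fin-injective : ∀ {a b} → fin a ≡ fin b → a ≡ b
  fin-injective refl = refl

  ≤ₘ-refl : ∀ {x} → x ≤ₘ x
  ≤ₘ-refl { -∞} = -∞≤
  ≤ₘ-refl {fin _} = fin≤ ≤-refl

  ≤ₘ-reflexive : ∀ {x y} → x ≡ y → x ≤ₘ y
  ≤ₘ-reflexive refl = ≤ₘ-refl

  ≤ₘ-trans : ∀ {x y z} → x ≤ₘ y → y ≤ₘ z → x ≤ₘ z
  ≤ₘ-trans -∞≤ _ = -∞≤
  ≤ₘ-trans (fin≤ h) (fin≤ h′) = fin≤ (≤-trans h h′)

  ≤ₘ-antisym : ∀ {x y} → x ≤ₘ y → y ≤ₘ x → x ≡ y
  ≤ₘ-antisym -∞≤ -∞≤ = refl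
  ≤ₘ-antisym (fin≤ h) (fin≤ h′) = cong fin (≤-antisym h h′)

  ≤ₘ-total : ∀ x y → x ≤ₘ y ⊎ y ≤ₘ x
  ≤ₘ-total -∞ _ = inj₁ -∞≤
  ≤ₘ-total _ -∞ = inj₂ -∞≤
  ≤ₘ-total (fin a) (fin b) = Sum.map fin≤ fin≤ (≤-total a b)

  _≤ₘ?_ : ∀ x y → Dec (x ≤ₘ y)
  -∞ ≤ₘ? _ = yes -∞≤
  fin _ ≤ₘ? -∞ = no λ ()
  fin a ≤ₘ? fin b = map′ fin≤ (λ { (fin≤ h) → h }) (a ≤? b)

  -∞? : ∀ x → Dec (x ≡ -∞)
  -∞? -∞ = yes refl
  -∞? (fin _) = no λ ()

  finite? : ∀ x → Dec (x ≢ -∞)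
  finite? x = ¬? (-∞? x)

  ≤-∞⇒≡-∞ : ∀ {x} → x ≤ₘ -∞ → x ≡ -∞
  ≤-∞⇒≡-∞ -∞≤ = refl

  ≤ₘ-finite : ∀ {x y} → x ≤ₘ y → x ≢ -∞ → y ≢ -∞
  ≤ₘ-finite x≤y x≢-∞ refl = x≢-∞ (≤-∞⇒≡-∞ x≤y)

  ⊕-sel : ∀ x y → x ⊕ y ≡ x ⊎ x ⊕ y ≡ y
  ⊕-sel -∞ _ = inj₂ refl
  ⊕-sel (fin _) -∞ = inj₁ refl
  ⊕-sel (fin a) (fin b) with a ≤? b
  ... | yes _ = inj₂ refl
  ... | no _ = inj₁ refl

  x≤x⊕y : ∀ x y → x ≤ₘ x ⊕ y
  x≤x⊕y -∞ _ = -∞≤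
  x≤x⊕y (fin _) -∞ = ≤ₘ-refl
  x≤x⊕y (fin a) (fin b) with a ≤? b
  ... | yes a≤b = fin≤ a≤b
  ... | no _ = ≤ₘ-refl

  y≤x⊕y : ∀ x y → y ≤ₘ x ⊕ y
  y≤x⊕y -∞ _ = ≤ₘ-refl
  y≤x⊕y (fin _) -∞ = -∞≤
  y≤x⊕y (fin a) (fin b) with a ≤? b
  ... | yes _ = ≤ₘ-refl
  ... | no a≰b = [ (λ a≤b → contradiction a≤b a≰b) , fin≤ ]′ (≤-total a b)

  ⊕-lub : ∀ {x y z} → x ≤ₘ z → y ≤ₘ z → x ⊕ y ≤ₘ z
  ⊕-lub {x} {y} x≤z y≤z with ⊕-sel x y
  ... | inj₁ eq rewrite eq = x≤z
  ... | inj₂ eq rewrite eq = y≤z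

  maxF-upper : (f : Fin n → Rmax) → ∀ j → f j ≤ₘ maxF f
  maxF-upper f zero = x≤x⊕y _ _
  maxF-upper f (suc j) = ≤ₘ-trans (maxF-upper (f ∘ suc) j) (y≤x⊕y (f zero) _)

  maxF-attained : (f : Fin n → Rmax) → maxF f ≡ -∞ ⊎ ∃ λ j → maxF f ≡ f j
  maxF-attained {zero} f = inj₁ refl
  maxF-attained {suc _} f with ⊕-sel (f zero) (maxF (f ∘ suc)) | maxF-attained (f ∘ suc)
  ... | inj₁ eq | _ = inj₂ (zero , eq)
  ... | inj₂ eq | inj₁ eq-∞ = inj₁ (trans eq eq-∞)
  ... | inj₂ eq | inj₂ (j , eqⱼ) = inj₂ (suc j , trans eq eqⱼ)

  ⊗-monoʳ : ∀ a {x y} → x ≤ₘ y → fin a ⊗ x ≤ₘ fin a ⊗ y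
  ⊗-monoʳ a -∞≤ = -∞≤
  ⊗-monoʳ a (fin≤ h) = fin≤ (+-monoʳ-≤ a h)

  ⊗-cancelˡ-≤ : ∀ a {x y} → fin a ⊗ x ≤ₘ fin a ⊗ y → x ≤ₘ y
  ⊗-cancelˡ-≤ a { -∞} _ = -∞≤
  ⊗-cancelˡ-≤ a {fin _} {fin _} (fin≤ h) = fin≤ (+-cancelˡ-≤ a h)

  ⊗-cancelˡ : ∀ a {x y} → fin a ⊗ x ≡ fin a ⊗ y → x ≡ y
  ⊗-cancelˡ a eq = ≤ₘ-antisym (⊗-cancelˡ-≤ a (≤ₘ-reflexive eq)) (⊗-cancelˡ-≤ a (≤ₘ-reflexive (sym eq)))

  ⊗-exchange : ∀ a b x → fin a ⊗ (fin b ⊗ x) ≡ fin b ⊗ (fin a ⊗ x)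
  ⊗-exchange a b -∞ = refl
  ⊗-exchange a b (fin c) = cong fin
    (trans (sym (+-assoc a b c)) (trans (cong (_+ c) (+-comm a b)) (+-assoc b a c)))

  a⊗-a⊗x≡x : ∀ a x → fin a ⊗ (fin (- a) ⊗ x) ≡ x
  a⊗-a⊗x≡x a -∞ = refl
  a⊗-a⊗x≡x a (fin c) = cong fin (trans (sym (+-assoc a (- a) c))
    (trans (cong (_+ c) (-‿inverseʳ a)) (+-identityˡ c)))

  ⊗-finite : ∀ {a x} → x ≢ -∞ → fin a ⊗ x ≢ -∞
  ⊗-finite { x = -∞} h _ = h refl

  ⊗-finite⁻ : ∀ {a x} → fin a ⊗ x ≢ -∞ → x ≢ -∞
  ⊗-finite⁻ h refl = h refl

  -- For lines of slopes `a < b` and heights `X`, `Y`, the sum of the two inequalities contradicts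
  -- `exchange-strict`. Finiteness of `X` excludes that both lines are `-∞`.
  no-crossing : ∀ {a b s t X Y} → X ≢ -∞ → a ℕ.< b → s < t →
                fin (a · s) ⊗ X ≤ₘ fin (b · s) ⊗ Y → ¬ fin (b · t) ⊗ Y ≤ₘ fin (a · t) ⊗ X
  no-crossing {X = -∞} h = contradiction refl h
  no-crossing {X = fin x} {fin y} _ a<b s<t (fin≤ h) (fin≤ h′) =
    exchange-strict x y a<b s<t (+-mono₂-≤ h′ h)

  -- From a meeting point on, the steeper line is on top: the common value at `s` cancels in
  -- `exchange`.
  tilt-up : ∀ {a b s t X Y} → a ℕ.≤ b → s ≤ t →
            fin (a · s) ⊗ X ≡ fin (b · s) ⊗ Y → fin (a · t) ⊗ X ≤ₘ fin (b · t) ⊗ Y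
  tilt-up {X = -∞} _ _ _ = -∞≤
  tilt-up {a} {b} {s} {t} {fin x} {fin y} a≤b s≤t eq = fin≤ (+-cancelʳ-≤ (a · s + x)
    (subst (λ z → (a · t + x) + z ≤ (b · t + y) + (a · s + x)) (sym (fin-injective eq))
      (exchange x y a≤b s≤t)))

  tilt-down : ∀ {a b s t X Y} → a ℕ.≤ b → s ≤ t →
              fin (a · t) ⊗ X ≡ fin (b · t) ⊗ Y → fin (b · s) ⊗ Y ≤ₘ fin (a · s) ⊗ X
  tilt-down {Y = -∞} _ _ _ = -∞≤
  tilt-down {a} {b} {s} {t} {fin x} {fin y} a≤b s≤t eq = fin≤ (+-cancelˡ-≤ (a · t + x)
    (subst (λ z → (a · t + x) + (b · s + y) ≤ z + (a · s + x)) (sym (fin-injective eq))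
      (exchange x y a≤b s≤t)))

  -- Discarding to `-∞` whatever reaches `b` keeps a maximum of such values strictly below a finite
  -- `b`.
  strictly-below : Rmax → Rmax → Rmax
  strictly-below b z with b ≤ₘ? z
  ... | yes _ = -∞
  ... | no _ = z

  strictly-below-≱ : ∀ {b} z → b ≢ -∞ → ¬ (b ≤ₘ strictly-below b z)
  strictly-below-≱ {b} z b≢-∞ h with b ≤ₘ? z
  ... | yes _ = b≢-∞ (≤-∞⇒≡-∞ h)
  ... | no b≰z = b≰z h

  ≤-strictly-below : ∀ {b z} → ¬ (b ≤ₘ z) → z ≤ₘ strictly-below b z
  ≤-strictly-below {b} {z} b≰z with b ≤ₘ? z
  ... | yes b≤z = contradiction b≤z b≰z
  ... | no _ = ≤ₘ-refl

  maxF-≱ : ∀ {b} (f : Fin n → Rmax) → b ≢ -∞ → (∀ j → ¬ (b ≤ₘ f j)) → ¬ (b ≤ₘ maxF f)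
  maxF-≱ f b≢-∞ h b≤max with maxF-attained f
  ... | inj₁ eq = b≢-∞ (≤-∞⇒≡-∞ (subst (_ ≤ₘ_) eq b≤max))
  ... | inj₂ (j , eq) = h j (subst (_ ≤ₘ_) eq b≤max)

-- Top columns of a row and membership in the cone.

module Cone (ℝ : RealField) {p d : ℕ} (t : Fin p → RealField.Carrier ℝ)
            (t-inc : Tropical.StrictlyIncreasing ℝ t) (ε : Fin p → Fin d → Sign) where
  open Tropical ℝ
  open OrderedGroup ℝ

  private
    variable
      x y : Fin d → Rmax
      i i′ : Fin p
      j j′ l : Fin d

  val : (Fin d → Rmax) → Fin p → Fin d → Rmax
  val x i j = fin (toℕ j · t i) ⊗ x j

  Arg : (Fin d → Rmax) → Fin p → Fin d → Set
  Arg x i j = ∀ j′ → val x i j′ ≤ₘ val x i j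

  -- When every entry is `-∞`, as can happen after a lowering, `Arg` holds of all columns;
  -- finiteness excludes this case.
  Top : (Fin d → Rmax) → Fin p → Fin d → Set
  Top x i j = x j ≢ -∞ × Arg x i j

  Top? : ∀ x i j → Dec (Top x i j)
  Top? x i j = finite? (x j) ×-dec Finₚ.all? (λ j′ → val x i j′ ≤ₘ? val x i j)

  t-mono : i Fin.≤ i′ → t i ≤ t i′
  t-mono {i} {i′} i≤i′ with Finₚ.<-cmp i i′
  ... | tri< i<i′ _ _ = proj₁ (t-inc i i′ i<i′)
  ... | tri≈ _ refl _ = ≤-refl
  ... | tri> _ _ i′<i = contradiction i≤i′ (ℕₚ.<⇒≱ i′<i)

  -- If `j′ < j`, the steeper line of `j`, already at least as high in row `i`, would be strictly
  -- higher in row `i′`.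
  Top-mono : Top x i j → Top x i′ j′ → i Fin.< i′ → j Fin.≤ j′
  Top-mono {i = i} {j = j} {i′ = i′} {j′ = j′} (_ , max) (xⱼ′≢-∞ , max′) i<i′ =
    ℕₚ.≮⇒≥ λ j′<j → no-crossing xⱼ′≢-∞ j′<j (t-inc i i′ i<i′) (max j′) (max′ j)

  Arg-resp-≥ : Arg x i j → val x i j ≤ₘ val x i j′ → Arg x i j′
  Arg-resp-≥ max h j″ = ≤ₘ-trans (max j″) h

  Top-resp-≥ : Top x i j → val x i j ≤ₘ val x i j′ → Top x i j′
  Top-resp-≥ (x≢-∞ , max) h = ⊗-finite⁻ (≤ₘ-finite h (⊗-finite x≢-∞)) , Arg-resp-≥ max h

  C⁻⊗≤val : ∀ x i j → C⁻ t ε i j ⊗ x j ≤ₘ val x i j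
  C⁻⊗≤val x i j with ε i j
  ... | plus = -∞≤
  ... | minus = ≤ₘ-refl

  C⁻⊗≡val : ∀ x → ε i j ≡ minus → C⁻ t ε i j ⊗ x j ≡ val x i j
  C⁻⊗≡val {i} {j} x eq with ε i j
  C⁻⊗≡val x refl | minus = refl

  C⁺⊗≡val : ∀ x → ε i j ≡ plus → C⁺ t ε i j ⊗ x j ≡ val x i j
  C⁺⊗≡val {i} {j} x eq with ε i j
  C⁺⊗≡val x refl | plus = refl

  K-intro : (∀ i → ∃ λ j → Arg x i j × ε i j ≡ plus) → K t ε x
  K-intro {x} args i with args i | maxF-attained (λ j → C⁻ t ε i j ⊗ x j)
  ... | _ | inj₁ eq = ≤ₘ-trans (≤ₘ-reflexive eq) -∞≤
  ... | j , max , plusⱼ | inj₂ (j′ , eq) = ≤ₘ-trans (≤ₘ-reflexive eq) (≤ₘ-trans (C⁻⊗≤val x i j′)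
    (≤ₘ-trans (max j′) (≤ₘ-trans (≤ₘ-reflexive (sym (C⁺⊗≡val x plusⱼ)))
      (maxF-upper (λ j → C⁺ t ε i j ⊗ x j) j))))

  -- Every value in the row is bounded by the plus side, as a term of it or through the constraint,
  -- so the row maximum is attained there. With `K-intro` this characterises the vectors of the cone
  -- that have a finite entry.
  K-elim : K t ε x → x l ≢ -∞ → ∀ i → ∃ λ j → Top x i j × ε i j ≡ plus
  K-elim {x} {l} x∈K xₗ≢-∞ i = attained (maxF-attained row⁺)
    where
    row⁺ row⁻ : Fin d → Rmax
    row⁺ j = C⁺ t ε i j ⊗ x j
    row⁻ j = C⁻ t ε i j ⊗ x j

    bound : ∀ j → val x i j ≤ₘ maxF row⁺
    bound j with ε i j in eq
    ... | plus = ≤ₘ-trans (≤ₘ-reflexive (sym (C⁺⊗≡val x eq))) (maxF-upper row⁺ j)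
    ... | minus = ≤ₘ-trans (≤ₘ-reflexive (sym (C⁻⊗≡val x eq))) (≤ₘ-trans (maxF-upper row⁻ j) (x∈K i))

    max-finite : maxF row⁺ ≢ -∞
    max-finite = ≤ₘ-finite (bound l) (⊗-finite xₗ≢-∞)

    attained : maxF row⁺ ≡ -∞ ⊎ (∃ λ j → maxF row⁺ ≡ row⁺ j) → ∃ λ j → Top x i j × ε i j ≡ plus
    attained (inj₁ eq) = contradiction eq max-finite
    attained (inj₂ (j , eq)) with ε i j in sgn
    ... | minus = contradiction eq max-finite
    ... | plus = j , (⊗-finite⁻ (λ eq-∞ → max-finite (trans eq eq-∞))
                     , λ j′ → subst (val x i j′ ≤ₘ_) eq (bound j′)) , sgn

  -- Agreement at a top column gives `y` the row maximum of `x`. Where a plus column of `y` attains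
  -- it, `y ≤ x` and the maximality in `x` force equality.
  tight-plus : K t ε y → (∀ j → y j ≤ₘ x j) → Top x i j → y j ≡ x j →
               ∃ λ j⁺ → Top x i j⁺ × ε i j⁺ ≡ plus × y j⁺ ≡ x j⁺
  tight-plus {y} {x} {i} {j} y∈K y≤x top@(xⱼ≢-∞ , max) eq
    with K-elim y∈K (subst (_≢ -∞) (sym eq) xⱼ≢-∞) i
  ... | j⁺ , (_ , maxʸ) , plus⁺ = j⁺ , Top-resp-≥ top (≤ₘ-trans xⱼ≤yⱼ⁺ (⊗-monoʳ _ (y≤x j⁺))) , plus⁺
    , ≤ₘ-antisym (y≤x j⁺) (⊗-cancelˡ-≤ (toℕ j⁺ · t i) (≤ₘ-trans (max j⁺) xⱼ≤yⱼ⁺))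
    where
    xⱼ≤yⱼ⁺ : val x i j ≤ₘ val y i j⁺
    xⱼ≤yⱼ⁺ = ≤ₘ-trans (≤ₘ-reflexive (cong (fin (toℕ j · t i) ⊗_) (sym eq))) (maxʸ j)

  -- Vectors fitting a lattice path.

  module _ (P : LatticePath p d) where
    open LatticePath P

    -- The support of x is the set of columns of P, and the rows of P are the breaks of the upper envelope
    -- of the lines j · t + x j.
    record Fits (x : Fin d → Rmax) : Set where
      field
        support : ∀ j → x j ≢ -∞ → ∃ λ r → lookup J r ≡ j
        finite  : ∀ r → x (lookup J r) ≢ -∞
        left    : ∀ r → Top x (lookup I r) (lookup J (inject₁ r))
        right   : ∀ r → Top x (lookup I r) (lookup J (suc r))

    consecutive-< : ∀ r → lookup J (inject₁ r) Fin.< lookup J (suc r)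
    consecutive-< r = J-inc (inject₁ r) (suc r) (inject₁<suc r)

    Balanced : (Fin d → Rmax) → Set
    Balanced x = ∀ r → val x (lookup I r) (lookup J (inject₁ r)) ≡ val x (lookup I r) (lookup J (suc r))

    -- Neighbouring lines meet at or after row `i` to the right of column `m`, and at or before it
    -- to the left, so values in row `i` do not increase when moving away from `m`.
    envelope : (∀ j → x j ≢ -∞ → ∃ λ r → lookup J r ≡ j) → Balanced x →
               ∀ i m → (∀ s → toℕ s ℕ.< toℕ m → lookup I s Fin.≤ i) →
               (∀ s → toℕ m ℕ.≤ toℕ s → i Fin.≤ lookup I s) → Arg x i (lookup J m)
    envelope {x} support balanced i m below above j with finite? (x j)
    ... | no ¬fin = subst (_≤ₘ val x i (lookup J m))
                      (sym (cong (fin (toℕ j · t i) ⊗_) (decidable-stable (-∞? (x j)) ¬fin))) -∞≤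
    ... | yes xⱼ≢-∞ with support j xⱼ≢-∞
    ...   | r , refl = spread (λ r → val x i (lookup J r) ≤ₘ val x i (lookup J m)) m ≤ₘ-refl
      (λ s m≤s → ≤ₘ-trans (tilt-down (ℕₚ.<⇒≤ (consecutive-< s)) (t-mono (above s m≤s)) (balanced s)))
      (λ s s<m → ≤ₘ-trans (tilt-up (ℕₚ.<⇒≤ (consecutive-< s)) (t-mono (below s s<m)) (balanced s)))
      r

    fits-balanced : Fits x → Balanced x
    fits-balanced fits r = ≤ₘ-antisym (proj₂ (right r) _) (proj₂ (left r) _)
      where open Fits fits

    -- Any other path column belongs to a segment whose two ends are top in an earlier or later row;
    -- `Top-mono` would reverse those ends.
    fits-column : Fits x → ∀ r → Top x (lookup I r) j →
                  j ≡ lookup J (inject₁ r) ⊎ j ≡ lookup J (suc r)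
    fits-column {x} {j} fits r top with Fits.support fits j (proj₁ top)
    ... | s , refl with ℕₚ.<-cmp (toℕ s) (toℕ r)
    ...   | tri≈ _ s≡r _ = inj₁ (cong (lookup J) (Finₚ.toℕ-injective (trans s≡r (sym (Finₚ.toℕ-inject₁ r)))))
    ...   | tri< s<r _ _ with <⇒inject₁ s s<r (ℕₚ.<⇒≤ (Finₚ.toℕ<n r))
    ...     | q , refl , q<r = contradiction (Top-mono (Fits.right fits q) top (I-inc q r q<r))
                                            (ℕₚ.<⇒≱ (consecutive-< q))
    fits-column fits r top | suc q , refl | tri> _ _ (s≤s r≤q) with Finₚ.<-cmp r q
    ... | tri< r<q _ _ = contradiction (Top-mono top (Fits.left fits q) (I-inc r q r<q))
                                      (ℕₚ.<⇒≱ (consecutive-< q))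
    ... | tri≈ _ refl _ = inj₂ refl
    ... | tri> _ _ q<r = contradiction r≤q (ℕₚ.<⇒≱ q<r)

    -- Balance determines each coordinate from the previous one, so the ratio at the first column
    -- propagates.
    fits⇒sameRay : Fits x → Fits y → SameRay x y
    fits⇒sameRay {x} {y} fitsˣ fitsʸ = scale (ratio (Fits.finite fitsˣ zero) (Fits.finite fitsʸ zero))
      where
      ratio : ∀ {X Y} → X ≢ -∞ → Y ≢ -∞ → ∃ λ c → Y ≡ fin c ⊗ X
      ratio { -∞} h _ = contradiction refl h
      ratio {fin _} { -∞} _ h = contradiction refl h
      ratio {fin a} {fin b} _ _ = b + - a , cong fin (sym (x-z+z≡x b a))

      module _ {c} (base : y (lookup J zero) ≡ fin c ⊗ x (lookup J zero)) where
        step : ∀ r → y (lookup J (inject₁ r)) ≡ fin c ⊗ x (lookup J (inject₁ r)) →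
               y (lookup J (suc r)) ≡ fin c ⊗ x (lookup J (suc r))
        step r eq = ⊗-cancelˡ b (begin
          fin b ⊗ y j₁            ≡⟨ fits-balanced fitsʸ r ⟨
          fin a ⊗ y j₀            ≡⟨ cong (fin a ⊗_) eq ⟩
          fin a ⊗ (fin c ⊗ x j₀)  ≡⟨ ⊗-exchange a c (x j₀) ⟩
          fin c ⊗ (fin a ⊗ x j₀)  ≡⟨ cong (fin c ⊗_) (fits-balanced fitsˣ r) ⟩
          fin c ⊗ (fin b ⊗ x j₁)  ≡⟨ ⊗-exchange c b (x j₁) ⟩
          fin b ⊗ (fin c ⊗ x j₁)  ∎)
          where
          open ≡-Reasoning
          j₀ j₁ : Fin d
          j₀ = lookup J (inject₁ r)
          j₁ = lookup J (suc r)
          a b : Carrier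
          a = toℕ j₀ · t (lookup I r)
          b = toℕ j₁ · t (lookup I r)

        on-path : ∀ r → y (lookup J r) ≡ fin c ⊗ x (lookup J r)
        on-path = <-weakInduction _ base step

      scale : (∃ λ c → y (lookup J zero) ≡ fin c ⊗ x (lookup J zero)) → SameRay x y
      scale (c , base) = c , at
        where
        at : ∀ j → y j ≡ fin c ⊗ x j
        at j with x j in eqˣ | y j in eqʸ
        ... | -∞ | -∞ = refl
        ... | fin _ | _ with Fits.support fitsˣ j (λ eq → contradiction (trans (sym eqˣ) eq) λ ())
        ...   | r , refl = trans (sym eqʸ) (trans (on-path base r) (cong (fin c ⊗_) eqˣ))
        at j | -∞ | fin _ with Fits.support fitsʸ j (λ eq → contradiction (trans (sym eqʸ) eq) λ ())
        ...   | r , refl = trans (sym eqʸ) (trans (on-path base r) (cong (fin c ⊗_) eqˣ))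

    fits-scale : SameRay x y → Fits x → Fits y
    fits-scale {x} {y} (c , eq) fits = record
      { support = λ j yⱼ≢-∞ → support j (⊗-finite⁻ (subst (_≢ -∞) (eq j) yⱼ≢-∞))
      ; finite  = λ r → scale-finite (finite r)
      ; left    = λ r → scale-top (left r)
      ; right   = λ r → scale-top (right r)
      }
      where
      open Fits fits
      scale-finite : x j ≢ -∞ → y j ≢ -∞
      scale-finite {j} h = subst (_≢ -∞) (sym (eq j)) (⊗-finite h)

      scale-val : ∀ i j → val y i j ≡ fin c ⊗ val x i j
      scale-val i j = trans (cong (fin (toℕ j · t i) ⊗_) (eq j)) (⊗-exchange _ c (x j))

      scale-top : Top x i j → Top y i j
      scale-top {i} {j} (h , max) = scale-finite h
        , λ j′ → subst₂ _≤ₘ_ (sym (scale-val i j′)) (sym (scale-val i j)) (⊗-monoʳ c (max j′))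

    -- The constraint at the minus end of a horizontal segment keeps the coordinate at its plus end from decreasing;
    -- by (C5) these constraints propagate from the pivot column to all columns of the path.
    module _ (fits : Fits x) (allowed : TropicallyAllowed ε P) where
      private
        open Fits fits
        c4 : C4 ε P
        c4 = proj₂ (proj₂ (proj₂ (proj₁ allowed)))

      fits-pivot : ∃ λ (m : Fin (suc k)) → (∀ s → toℕ s ℕ.< toℕ m → horiz ε P s ≡ (plus , minus))
                                        × (∀ s → toℕ m ℕ.≤ toℕ s → horiz ε P s ≡ (minus , plus))
      fits-pivot = threshold c4 (proj₂ allowed)

      pivot-column : Fin d
      pivot-column = lookup J (proj₁ fits-pivot)

      rigid : K t ε y → (∀ j → y j ≤ₘ x j) → y pivot-column ≡ x pivot-column → ∀ j → x j ≡ y j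
      rigid {y} y∈K y≤x eq j with x j in eqˣ
      ... | -∞ = sym (≤-∞⇒≡-∞ (subst (y j ≤ₘ_) eqˣ (y≤x j)))
      ... | fin _ with support j (λ eq → contradiction (trans (sym eqˣ) eq) λ ())
      ...   | r , refl = trans (sym eqˣ) (sym (spread E (proj₁ fits-pivot) eq up down r))
        where
        E : Fin (suc k) → Set
        E r = y (lookup J r) ≡ x (lookup J r)

        up : ∀ s → toℕ (proj₁ fits-pivot) ℕ.≤ toℕ s → E (inject₁ s) → E (suc s)
        -- The plus column found is an end of segment `s`, and the signs leave only the right end.
        up s m≤s e with tight-plus y∈K y≤x (left s) e | proj₂ (proj₂ fits-pivot) s m≤s
        ... | j⁺ , top , plus⁺ , e⁺ | sgn with fits-column fits s top
        ...   | inj₁ refl = contradiction (cong proj₁ sgn) (plus≢minus plus⁺)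
        ...   | inj₂ refl = e⁺

        down : ∀ s → toℕ s ℕ.< toℕ (proj₁ fits-pivot) → E (suc s) → E (inject₁ s)
        down s s<m e with tight-plus y∈K y≤x (right s) e | proj₁ (proj₂ fits-pivot) s s<m
        ... | j⁺ , top , plus⁺ , e⁺ | sgn with fits-column fits s top
        ...   | inj₁ refl = e⁺
        ...   | inj₂ refl = contradiction (cong proj₂ sgn) (plus≢minus plus⁺)

      -- At the pivot column one of `v`, `w` agrees with `x`, and `rigid` extends the agreement to
      -- all columns.
      fits-indecomposable : ∀ v w → K t ε v → K t ε w → (∀ j → x j ≡ v j ⊕ w j) →
                            (∀ j → x j ≡ v j) ⊎ (∀ j → x j ≡ w j)
      fits-indecomposable v w v∈K w∈K eq with ⊕-sel (v pivot-column) (w pivot-column)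
      ... | inj₁ sel = inj₁ (rigid v∈K (λ j → subst (v j ≤ₘ_) (sym (eq j)) (x≤x⊕y _ _))
                               (sym (trans (eq pivot-column) sel)))
      ... | inj₂ sel = inj₂ (rigid w∈K (λ j → subst (w j ≤ₘ_) (sym (eq j)) (y≤x⊕y (v j) _))
                               (sym (trans (eq pivot-column) sel)))

  -- From paths to extreme generators.

  vertical-plus : (P : LatticePath p d) (let open LatticePath P) → Allowed ε P →
                  ∀ i r → (∀ s → toℕ s ℕ.< toℕ r → lookup I s Fin.< i) →
                  (∀ s → toℕ r ℕ.≤ toℕ s → i Fin.< lookup I s) → ε i (lookup J r) ≡ plus
  -- (C1), (C2) and (C3) merge into one statement about the rows strictly between two consecutive
  -- segments, with no bound at an end of the path.
  vertical-plus record { k = zero } (_ , c2 , _) i zero _ _ = c2 i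
  vertical-plus record { k = suc _ } (c1 , _) i zero _ above = c1 i (above zero z≤n)
  vertical-plus record { k = suc _ } (_ , c2 , c3 , _) i (suc r) below above with view r
  ... | ‵fromℕ = c2 i (below (fromℕ _) ℕₚ.≤-refl)
  ... | ‵inject₁ q = c3 (inject₁ q) (suc q) (cong suc (sym (Finₚ.toℕ-inject₁ q))) i
    (below (inject₁ q) ℕₚ.≤-refl) (above (suc q) (ℕₚ.≤-reflexive (cong suc (Finₚ.toℕ-inject₁ q))))

  -- On a path row the plus end of the segment serves; on any other row, the column of the vertical
  -- segment through it, maximal by `envelope`.
  fits⇒K : (P : LatticePath p d) → Fits P x → Allowed ε P → K t ε x
  fits⇒K {x} P fits allowed = K-intro row
    where
    open LatticePath P
    row : ∀ i → ∃ λ j → Arg x i j × ε i j ≡ plus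
    row i with Finₚ.any? (λ s → lookup I s Finₚ.≟ i)
    ... | yes (s , refl) with proj₂ (proj₂ (proj₂ allowed)) s
    ...   | inj₁ sgn = _ , proj₂ (Fits.left fits s) , cong proj₁ sgn
    ...   | inj₂ sgn = _ , proj₂ (Fits.right fits s) , cong proj₂ sgn
    row i | no ¬on with threshold {A = λ s → lookup I s Fin.< i} {B = λ s → i Fin.< lookup I s} side
                          (λ r s i<I r≤s → ℕₚ.<-≤-trans i<I (increasing-mono-≤ I-inc r≤s))
      where
      side : ∀ s → lookup I s Fin.< i ⊎ i Fin.< lookup I s
      side s with Finₚ.<-cmp (lookup I s) i
      ... | tri< lt _ _ = inj₁ lt
      ... | tri≈ _ eq _ = contradiction (s , eq) ¬on
      ... | tri> _ _ gt = inj₂ gt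
    ... | m , below , above = lookup J m
      , envelope P (Fits.support fits) (fits-balanced P fits) i m
          (λ s s<m → ℕₚ.<⇒≤ (below s s<m)) (λ s m≤s → ℕₚ.<⇒≤ (above s m≤s))
      , vertical-plus P allowed i m below above

  fits⇒extreme : (P : LatticePath p d) → Fits P x → TropicallyAllowed ε P → ExtremeGenerator t ε x
  fits⇒extreme P fits allowed = fits⇒K P fits (proj₁ allowed) , (_ , Fits.finite fits zero)
    , fits-indecomposable P fits allowed

  -- A vector fitting a given path.

  heights : (Fin (suc n) → Fin d) → (Fin n → Fin p) → Carrier → Fin (suc n) → Carrier
  heights J I c zero = c
  -- The new starting height makes the first two lines meet in row `I zero`.
  heights {suc _} J I c (suc r) = heights (J ∘ suc) (I ∘ suc)
    (toℕ (J zero) · t (I zero) + c + - (toℕ (J (suc zero)) · t (I zero))) r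

  heights-balanced : ∀ J (I : Fin n → Fin p) c r →
    toℕ (J (inject₁ r)) · t (I r) + heights J I c (inject₁ r) ≡ toℕ (J (suc r)) · t (I r) + heights J I c (suc r)
  heights-balanced J I c zero = sym (trans (+-comm _ _) (x-z+z≡x _ _))
  heights-balanced {suc _} J I c (suc r) = heights-balanced (J ∘ suc) (I ∘ suc) _ r

  fitting : (P : LatticePath p d) → ∃ (Fits P)
  fitting P = u , record
    { support = supp
    ; finite  = finite
    ; left    = λ r → finite (inject₁ r) , left r
    ; right   = λ r → finite (suc r) , Arg-resp-≥ (left r) (≤ₘ-reflexive (balanced r))
    }
    where
    open LatticePath P
    h : Fin (suc k) → Carrier
    h = heights (lookup J) (lookup I) 0#

    u : Fin d → Rmax
    u j with Finₚ.any? (λ r → lookup J r Finₚ.≟ j)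
    ... | yes (r , _) = fin (h r)
    ... | no _ = -∞

    supp : ∀ j → u j ≢ -∞ → ∃ λ r → lookup J r ≡ j
    supp j uⱼ≢-∞ with Finₚ.any? (λ r → lookup J r Finₚ.≟ j)
    ... | yes found = found
    ... | no _ = contradiction refl uⱼ≢-∞

    u∘J : ∀ r → u (lookup J r) ≡ fin (h r)
    u∘J r with Finₚ.any? (λ s → lookup J s Finₚ.≟ lookup J r)
    ... | yes (s , eq) = cong (fin ∘ h) (increasing-injective J-inc eq)
    ... | no none = contradiction (r , refl) none

    finite : ∀ r → u (lookup J r) ≢ -∞
    finite r eq = contradiction (trans (sym (u∘J r)) eq) λ ()

    balanced : Balanced P u
    balanced r rewrite u∘J (inject₁ r) | u∘J (suc r) = cong fin (heights-balanced (lookup J) (lookup I) 0# r)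

    left : ∀ r → Arg u (lookup I r) (lookup J (inject₁ r))
    -- The bounds of `envelope` are weak, so the row may be `I r` itself.
    left r = envelope P supp balanced (lookup I r) (inject₁ r)
      (λ s s<r → increasing-mono-≤ I-inc (ℕₚ.<⇒≤ (subst (toℕ s ℕ.<_) (Finₚ.toℕ-inject₁ r) s<r)))
      (λ s r≤s → increasing-mono-≤ I-inc (subst (ℕ._≤ toℕ s) (Finₚ.toℕ-inject₁ r) r≤s))

  -- A row is recovered as the only one where both ends of a segment are top.
  fits-unique : (P Q : LatticePath p d) → Fits P x → Fits Q x → SamePath P Q
  fits-unique {x} P@record { k = k } Q@record { k = k′ } fitsᴾ fitsᴼ =
    same-length (ℕₚ.suc-injective (ℕₚ.≤-antisym (range-⊆⇒≤ (J-inc P) (J-inc Q) σ) (range-⊆⇒≤ (J-inc Q) (J-inc P) τ)))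
    where
    open LatticePath using (I; J; I-inc; J-inc)
    σ : ∀ r → ∃ λ s → lookup (J Q) s ≡ lookup (J P) r
    σ r = Fits.support fitsᴼ _ (Fits.finite fitsᴾ r)

    τ : ∀ s → ∃ λ r → lookup (J P) r ≡ lookup (J Q) s
    τ s = Fits.support fitsᴾ _ (Fits.finite fitsᴼ s)

    same-length : k ≡ k′ → SamePath P Q
    same-length refl = lookup-ext (I P) (I Q) same-row , lookup-ext (J P) (J Q) same-column
      where
      same-column : ∀ r → lookup (J P) r ≡ lookup (J Q) r
      same-column r = Finₚ.toℕ-injective (ℕₚ.≤-antisym
        (range-⊆⇒≥ (J-inc Q) (J-inc P) τ r) (range-⊆⇒≥ (J-inc P) (J-inc Q) σ r))

      same-row : ∀ r → lookup (I P) r ≡ lookup (I Q) r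
      same-row r with Finₚ.<-cmp (lookup (I P) r) (lookup (I Q) r)
      ... | tri≈ _ eq _ = eq
      ... | tri< lt _ _ = contradiction
        (Top-mono (Fits.right fitsᴾ r) (Fits.left fitsᴼ r) lt)
        (ℕₚ.<⇒≱ (subst (λ j → j Fin.< lookup (J P) (suc r)) (same-column (inject₁ r)) (consecutive-< P r)))
      ... | tri> _ _ gt = contradiction
        (Top-mono (Fits.right fitsᴼ r) (Fits.left fitsᴾ r) gt)
        (ℕₚ.<⇒≱ (subst (λ j → j Fin.< lookup (J Q) (suc r)) (sym (same-column (inject₁ r))) (consecutive-< Q r)))

  -- Row `i` has a top column of sign plus; `Top-mono` against the segments above and below excludes
  -- every path column but `lookup J r`.
  fits⇒vertical-plus : (P : LatticePath p d) (let open LatticePath P) → Fits P x → K t ε x →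
                       ∀ i r → (∀ s → toℕ s ℕ.< toℕ r → lookup I s Fin.< i) →
                       (∀ s → toℕ r ℕ.≤ toℕ s → i Fin.< lookup I s) → ε i (lookup J r) ≡ plus
  fits⇒vertical-plus {x} P fits x∈K i r below above
    with K-elim x∈K (Fits.finite fits r) i
  ... | j , top , plusⱼ with Fits.support fits j (proj₁ top)
  ...   | s , refl with Finₚ.<-cmp s r
  ...     | tri≈ _ refl _ = plusⱼ
  fits⇒vertical-plus {x} P fits x∈K i r below above | _ , top , _ | s , refl | tri< s<r _ _
    with <⇒inject₁ s s<r (Finₚ.toℕ≤pred[n] r)
  ... | q , refl , q<r = contradiction (Top-mono (Fits.right fits q) top (below q q<r))
                                      (ℕₚ.<⇒≱ (consecutive-< P q))
  fits⇒vertical-plus {x} P fits x∈K i r below above | _ , top , _ | suc s , refl | tri> _ _ (s≤s r≤s) =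
    contradiction (Top-mono top (Fits.left fits s) (above s r≤s)) (ℕₚ.<⇒≱ (consecutive-< P s))

  fits⇒C1C2C3 : (P : LatticePath p d) → Fits P x → K t ε x → C1 ε P × C2 ε P × C3 ε P
  fits⇒C1C2C3 P fits x∈K = c1 P (vertical P fits) , c2 P (vertical P fits) , c3 P (vertical P fits)
    where
    -- The path is a parameter because (C1) and (C2) reduce only once `k` is matched.
    Vertical : LatticePath p d → Set
    Vertical P = ∀ i r → (∀ s → toℕ s ℕ.< toℕ r → lookup I s Fin.< i) →
                 (∀ s → toℕ r ℕ.≤ toℕ s → i Fin.< lookup I s) → ε i (lookup J r) ≡ plus
      where open LatticePath P

    vertical : (P : LatticePath p d) → Fits P _ → Vertical P
    vertical P fits = fits⇒vertical-plus P fits x∈K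

    c1 : ∀ P → Vertical P → C1 ε P
    c1 record { k = zero } _ = _
    c1 record { k = suc _ ; I-inc = I-inc } v i i<I₀ =
      v i zero (λ _ ()) (λ s _ → ℕₚ.<-≤-trans i<I₀ (increasing-mono-≤ I-inc z≤n))

    c2 : ∀ P → Vertical P → C2 ε P
    c2 record { k = zero } v i = v i zero (λ ()) (λ ())
    c2 record { k = suc m ; I-inc = I-inc } v i I<i = v i (suc (fromℕ m))
      (λ s _ → ℕₚ.≤-<-trans (increasing-mono-≤ I-inc (Finₚ.≤fromℕ s)) I<i)
      (λ s m<s → contradiction (Finₚ.≤fromℕ s) (ℕₚ.<⇒≱ m<s))

    c3 : ∀ P → Vertical P → C3 ε P
    c3 P v a b b≡1+a i Iₐ<i i<I_b = v i (inject₁ b)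
      (λ s s<b → ℕₚ.≤-<-trans (increasing-mono-≤ I-inc
        (ℕ.s≤s⁻¹ (subst (toℕ s ℕ.<_) (trans (Finₚ.toℕ-inject₁ b) b≡1+a) s<b))) Iₐ<i)
      (λ s b≤s → ℕₚ.<-≤-trans i<I_b (increasing-mono-≤ I-inc
        (subst (ℕ._≤ toℕ s) (Finₚ.toℕ-inject₁ b) b≤s)))
      where open LatticePath P

  -- Lowering one coordinate.

  candidate : (Fin d → Rmax) → Fin d → Fin p → Fin d → Rmax
  -- The second argument is the height at which column `l` ties with column `j` in row `i`; for
  -- `j = l` it is `x l`, which `strictly-below` discards.
  candidate x l i j = strictly-below (x l) (fin (- (toℕ l · t i)) ⊗ val x i j)

  -- The largest value below x l at which column l ties with another column in some row.
  level : (Fin d → Rmax) → Fin d → Rmax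
  level x l = maxF λ i → maxF (candidate x l i)

  level-≱ : ∀ x l → x l ≢ -∞ → ¬ (x l ≤ₘ level x l)
  level-≱ x l xₗ≢-∞ = maxF-≱ (λ i → maxF (candidate x l i)) xₗ≢-∞ λ i →
    maxF-≱ (candidate x l i) xₗ≢-∞ λ j → strictly-below-≱ (fin (- (toℕ l · t i)) ⊗ val x i j) xₗ≢-∞

  -- The tie height with `j` is strictly below `x l`, hence among the values maximised by `level`.
  level-dominates : ∀ x i l j → ¬ (val x i l ≤ₘ val x i j) → val x i j ≤ₘ fin (toℕ l · t i) ⊗ level x l
  level-dominates x i l j l≰j = subst (_≤ₘ fin c ⊗ level x l) (a⊗-a⊗x≡x c (val x i j)) (⊗-monoʳ c
    (≤ₘ-trans (≤-strictly-below λ h → l≰j (subst (val x i l ≤ₘ_) (a⊗-a⊗x≡x c (val x i j)) (⊗-monoʳ c h)))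
      (≤ₘ-trans (maxF-upper (candidate x l i) j) (maxF-upper (λ i → maxF (candidate x l i)) i))))
    where
    c : Carrier
    c = toℕ l · t i

  lower : (Fin d → Rmax) → Fin d → Fin d → Rmax
  lower x l j with j Finₚ.≟ l
  ... | yes _ = level x l
  ... | no _ = x j

  lower-at : ∀ x l → lower x l l ≡ level x l
  lower-at x l with l Finₚ.≟ l
  ... | yes _ = refl
  ... | no l≢l = contradiction refl l≢l

  lower-off : ∀ x → j ≢ l → lower x l j ≡ x j
  lower-off {j} {l} x j≢l with j Finₚ.≟ l
  ... | yes j≡l = contradiction j≡l j≢l
  ... | no _ = refl

  lower-≤ : ∀ x l → x l ≢ -∞ → ∀ j → lower x l j ≤ₘ x j
  lower-≤ x l xₗ≢-∞ j with j Finₚ.≟ l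
  ... | no _ = ≤ₘ-refl
  ... | yes refl = [ id , (λ h → contradiction h (level-≱ x l xₗ≢-∞)) ]′ (≤ₘ-total (level x l) (x l))

  -- A row whose constraint is violated as soon as x l alone is decreased.
  Reason : (Fin d → Rmax) → Fin d → Set
  Reason x l = ∃ λ i → Top x i l × ε i l ≡ plus × (∃ λ n → Top x i n × ε i n ≡ minus)
                     × (∀ j → Top x i j → ε i j ≡ plus → j ≡ l)

  reason? : ∀ x l → Dec (Reason x l)
  reason? x l = Finₚ.any? λ i → Top? x i l ×-dec (ε i l ≟ₛ plus)
    ×-dec Finₚ.any? (λ n → Top? x i n ×-dec (ε i n ≟ₛ minus))
    ×-dec Finₚ.all? (λ j → Top? x i j →-dec ((ε i j ≟ₛ plus) →-dec (j Finₚ.≟ l)))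

  -- A row with a plus top column other than `l` keeps it. Otherwise `l` is the only one, and
  -- without a reason no minus column ties with it, so `level` leaves `l` maximal.
  lower∈K : K t ε x → x l ≢ -∞ → ¬ Reason x l → K t ε (lower x l)
  lower∈K {x} {l} x∈K xₗ≢-∞ ¬reason = K-intro row
    where
    lower-val : ∀ i j → val (lower x l) i j ≤ₘ val x i j
    lower-val i j = ⊗-monoʳ _ (lower-≤ x l xₗ≢-∞ j)

    row : ∀ i → ∃ λ j → Arg (lower x l) i j × ε i j ≡ plus
    row i with Finₚ.any? (λ j → Top? x i j ×-dec (ε i j ≟ₛ plus) ×-dec ¬? (j Finₚ.≟ l))
    ... | yes (j , (_ , max) , plusⱼ , j≢l) = j
      , (λ j′ → ≤ₘ-trans (lower-val i j′) (≤ₘ-trans (max j′)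
          (≤ₘ-reflexive (cong (fin (toℕ j · t i) ⊗_) (sym (lower-off x j≢l))))))
      , plusⱼ
    ... | no none with K-elim x∈K xₗ≢-∞ i
    ...   | j , top , plusⱼ with only j top plusⱼ
      where
      only : ∀ j → Top x i j → ε i j ≡ plus → j ≡ l
      only j top plusⱼ = decidable-stable (j Finₚ.≟ l) λ j≢l → none (j , top , plusⱼ , j≢l)
    ...     | refl = l , arg , plusⱼ
      where
      arg : Arg (lower x l) i l
      arg j′ with j′ Finₚ.≟ l
      ... | yes refl = ≤ₘ-reflexive (cong (fin (toℕ l · t i) ⊗_) (sym (lower-at x l)))
      ... | no j′≢l = ≤ₘ-trans (level-dominates x i l j′ not-tied)
                        (≤ₘ-reflexive (cong (fin (toℕ l · t i) ⊗_) (sym (lower-at x l))))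
        where
        not-tied : ¬ (val x i l ≤ₘ val x i j′)
        not-tied h with ε i j′ in sgn
        ... | plus = none (j′ , Top-resp-≥ top h , sgn , j′≢l)
        ... | minus = ¬reason (i , top , plusⱼ , (j′ , Top-resp-≥ top h , sgn)
          , λ j topⱼ sgnⱼ → decidable-stable (j Finₚ.≟ l) λ j≢l → none (j , topⱼ , sgnⱼ , j≢l))

  -- If both columns lacked a reason, `x` would be the maximum of its two lowerings, each of which
  -- differs from it.
  extreme⇒reason : ExtremeGenerator t ε x → l ≢ j → x l ≢ -∞ → x j ≢ -∞ → ¬ Reason x l → Reason x j
  extreme⇒reason {x} {l} {j} (x∈K , _ , indecomposable) l≢j xₗ≢-∞ xⱼ≢-∞ ¬rₗ =
    decidable-stable (reason? x j) λ ¬rⱼ →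
      [ lowered xₗ≢-∞ , lowered xⱼ≢-∞ ]′
        (indecomposable (lower x l) (lower x j) (lower∈K x∈K xₗ≢-∞ ¬rₗ) (lower∈K x∈K xⱼ≢-∞ ¬rⱼ) join)
    where
    lowered : ∀ {l} → x l ≢ -∞ → ¬ (∀ j → x j ≡ lower x l j)
    lowered {l} xₗ≢-∞ eq = level-≱ x l xₗ≢-∞ (≤ₘ-reflexive (trans (eq l) (lower-at x l)))

    join : ∀ j′ → x j′ ≡ lower x l j′ ⊕ lower x j j′
    join j′ = ≤ₘ-antisym (upper (j′ Finₚ.≟ l)) (⊕-lub (lower-≤ x l xₗ≢-∞ j′) (lower-≤ x j xⱼ≢-∞ j′))
      where
      upper : Dec (j′ ≡ l) → x j′ ≤ₘ lower x l j′ ⊕ lower x j j′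
      upper (no j′≢l) = ≤ₘ-trans (≤ₘ-reflexive (sym (lower-off x j′≢l))) (x≤x⊕y (lower x l j′) (lower x j j′))
      upper (yes refl) = ≤ₘ-trans (≤ₘ-reflexive (sym (lower-off x l≢j))) (y≤x⊕y (lower x l l) (lower x j l))

  -- The exempt column `c` is where the segments will change from `(plus , minus)` to
  -- `(minus , plus)`.
  Reasoned : (Fin d → Rmax) → Fin d → Set
  Reasoned x c = ∀ l → x l ≢ -∞ → l ≢ c → Reason x l

  extreme⇒reasoned : ExtremeGenerator t ε x → ∃ λ c → x c ≢ -∞ × Reasoned x c
  extreme⇒reasoned {x} ext@(_ , (j₀ , x₀≢-∞) , _)
    with Finₚ.any? (λ l → finite? (x l) ×-dec ¬? (reason? x l))
  ... | yes (l , xₗ≢-∞ , ¬r) = l , xₗ≢-∞ , λ j xⱼ≢-∞ j≢l → extreme⇒reason ext (≢-sym j≢l) xₗ≢-∞ xⱼ≢-∞ ¬r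
  ... | no none = j₀ , x₀≢-∞ , λ j xⱼ≢-∞ _ → decidable-stable (reason? x j) λ ¬r → none (j , xⱼ≢-∞ , ¬r)

  -- Rows of reasons and their partners.

  module _ {x : Fin d → Rmax} where

    partner : Reason x l → Fin d
    partner (_ , _ , _ , (n , _) , _) = n

    -- A common row would have two plus top columns, against uniqueness; the reversed order
    -- contradicts `Top-mono`.
    reason-row-mono : (ρ : Reason x l) (ρ′ : Reason x j) → l Fin.< j → proj₁ ρ Fin.< proj₁ ρ′
    reason-row-mono (i , top , plusₗ , _ , only) (i′ , top′ , plusⱼ , _ , only′) l<j with Finₚ.<-cmp i i′
    ... | tri< i<i′ _ _ = i<i′
    ... | tri≈ _ refl _ = contradiction (cong toℕ (only′ _ top plusₗ)) (ℕₚ.<⇒≢ l<j)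
    ... | tri> _ _ i′<i = contradiction (Top-mono top′ top i′<i) (ℕₚ.<⇒≱ l<j)

    partner-≤ : (ρ : Reason x l) (ρ′ : Reason x j) → l Fin.< j → partner ρ Fin.≤ j
    partner-≤ ρ@(_ , _ , _ , (_ , topₙ , _) , _) ρ′@(_ , top′ , _) l<j =
      Top-mono topₙ top′ (reason-row-mono ρ ρ′ l<j)

    partner-≥ : (ρ : Reason x l) (ρ′ : Reason x j) → l Fin.< j → l Fin.≤ partner ρ′
    partner-≥ ρ@(_ , top , _) ρ′@(_ , _ , _ , (_ , topₙ , _) , _) l<j =
      Top-mono top topₙ (reason-row-mono ρ ρ′ l<j)

    partner-mono : (ρ : Reason x l) (ρ′ : Reason x j) → l Fin.< j → partner ρ Fin.≤ partner ρ′
    partner-mono ρ@(_ , _ , _ , (_ , topₙ , _) , _) ρ′@(_ , _ , _ , (_ , topₙ′ , _) , _) l<j =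
      Top-mono topₙ topₙ′ (reason-row-mono ρ ρ′ l<j)

    partner-finite : (ρ : Reason x l) → x (partner ρ) ≢ -∞
    partner-finite (_ , _ , _ , (_ , (fin-n , _) , _) , _) = fin-n

    partner-≢ : (ρ : Reason x l) → partner ρ ≢ l
    partner-≢ (_ , _ , plusₗ , (_ , _ , minusₙ) , _) refl = plus≢minus plusₗ minusₙ

    module _ {c : Fin d} (reasoned : Reasoned x c) where

      -- If the partner n of l < c were left of l, then the partner of n would be right of n by induction,
      -- contradicting the monotonicity of partners.
      partner-right : Acc Fin._<_ l → (ρ : Reason x l) → l Fin.< c → l Fin.< partner ρ
      partner-right {l} (acc rec) ρ l<c with Finₚ.<-cmp l (partner ρ)
      ... | tri< lt _ _ = lt
      ... | tri≈ _ eq _ = contradiction (sym eq) (partner-≢ ρ)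
      ... | tri> _ _ n<l = contradiction (partner-mono ρₙ ρ n<l)
          (ℕₚ.<⇒≱ (partner-right (rec n<l) ρₙ (ℕₚ.<-trans n<l l<c)))
        where
        ρₙ : Reason x (partner ρ)
        ρₙ = reasoned _ (partner-finite ρ) (Finₚ.<⇒≢ (ℕₚ.<-trans n<l l<c))

      -- Mirror image of `partner-right`: a partner `n` right of `l` would have its own partner left
      -- of `n`, while `partner-mono` places it at `n` or beyond.
      partner-left : Acc Fin._>_ l → (ρ : Reason x l) → c Fin.< l → partner ρ Fin.< l
      partner-left {l} (acc rec) ρ c<l with Finₚ.<-cmp l (partner ρ)
      ... | tri> _ _ gt = gt
      ... | tri≈ _ eq _ = contradiction (sym eq) (partner-≢ ρ)
      ... | tri< l<n _ _ = contradiction (partner-mono ρ ρₙ l<n)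
          (ℕₚ.<⇒≱ (partner-left (rec l<n) ρₙ (ℕₚ.<-trans c<l l<n)))
        where
        ρₙ : Reason x (partner ρ)
        ρₙ = reasoned _ (partner-finite ρ) (≢-sym (Finₚ.<⇒≢ (ℕₚ.<-trans c<l l<n)))

      -- A reason of `j` bounds the partner directly. For `j = c`, a partner beyond `c` would have
      -- its own partner on its left, against `partner-mono`.
      partner-next : (ρ : Reason x l) → l Fin.< c → x j ≢ -∞ → l Fin.< j → partner ρ Fin.≤ j
      partner-next {l} {j} ρ l<c xⱼ≢-∞ l<j with j Finₚ.≟ c
      ... | no j≢c = partner-≤ ρ (reasoned j xⱼ≢-∞ j≢c) l<j
      ... | yes refl = ℕₚ.≮⇒≥ λ c<n →
        let ρₙ = reasoned _ (partner-finite ρ) (≢-sym (Finₚ.<⇒≢ c<n))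
        in contradiction (partner-mono ρ ρₙ (ℕₚ.<-trans l<c c<n)) (ℕₚ.<⇒≱ (partner-left (>-wellFounded _) ρₙ c<n))

      partner-previous : (ρ : Reason x l) → c Fin.< l → x j ≢ -∞ → j Fin.< l → j Fin.≤ partner ρ
      partner-previous {l} {j} ρ c<l xⱼ≢-∞ j<l with j Finₚ.≟ c
      ... | no j≢c = partner-≥ (reasoned j xⱼ≢-∞ j≢c) ρ j<l
      ... | yes refl = ℕₚ.≮⇒≥ λ n<c →
        let ρₙ = reasoned _ (partner-finite ρ) (Finₚ.<⇒≢ n<c)
        in contradiction (partner-mono ρₙ ρ (ℕₚ.<-trans n<c c<l)) (ℕₚ.<⇒≱ (partner-right (<-wellFounded _) ρₙ n<c))

  -- From extreme generators to paths.

  Oriented : Fin d → Fin p → Fin d → Fin d → Set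
  -- Recording the side of `c` with the signs reduces (C5) to the order of columns.
  Oriented c i j₀ j₁ = (j₀ Fin.< c × ε i j₀ ≡ plus × ε i j₁ ≡ minus)
                     ⊎ (c Fin.≤ j₀ × ε i j₀ ≡ minus × ε i j₁ ≡ plus)

  -- Uniqueness of the plus top column is kept because it forces different segments into different
  -- rows.
  Segment : (Fin d → Rmax) → Fin d → Fin d → Fin d → Fin p → Set
  Segment x c j₀ j₁ i = Top x i j₀ × Top x i j₁ × Oriented c i j₀ j₁
                      × (∀ j j′ → Top x i j → Top x i j′ → ε i j ≡ plus → ε i j′ ≡ plus → j ≡ j′)

  -- Left of `c` the reason of `j₀` supplies the row, from `c` on the reason of `j₁`; as no support
  -- column lies between, the partner is the other end.
  segment : ∀ {c j₀ j₁} → Reasoned x c → x j₀ ≢ -∞ → x j₁ ≢ -∞ → j₀ Fin.< j₁ →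
            (∀ j → x j ≢ -∞ → j Fin.≤ j₀ ⊎ j₁ Fin.≤ j) → ∃ (Segment x c j₀ j₁)
  segment {x} {c} {j₀} {j₁} reasoned x₀≢-∞ x₁≢-∞ j₀<j₁ gap with j₀ Fin.<? c
  ... | yes j₀<c = from-left (reasoned j₀ x₀≢-∞ (Finₚ.<⇒≢ j₀<c))
    where
    from-left : Reason x j₀ → ∃ (Segment x c j₀ j₁)
    from-left ρ@(i , top , plus₀ , (n , topₙ , minusₙ) , only)
      with Finₚ.toℕ-injective (ℕₚ.≤-antisym (partner-next reasoned ρ j₀<c x₁≢-∞ j₀<j₁)
             ([ (λ n≤j₀ → contradiction (partner-right reasoned (<-wellFounded _) ρ j₀<c) (ℕₚ.≤⇒≯ n≤j₀)) , id ]′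
               (gap n (proj₁ topₙ))))
    ... | refl = i , top , topₙ , inj₁ (j₀<c , plus₀ , minusₙ)
      , λ j j′ tⱼ tⱼ′ pⱼ pⱼ′ → trans (only j tⱼ pⱼ) (sym (only j′ tⱼ′ pⱼ′))
  ... | no j₀≮c = from-right (reasoned j₁ x₁≢-∞ (≢-sym (Finₚ.<⇒≢ c<j₁)))
    where
    c<j₁ : c Fin.< j₁
    c<j₁ = ℕₚ.≤-<-trans (ℕₚ.≮⇒≥ j₀≮c) j₀<j₁

    from-right : Reason x j₁ → ∃ (Segment x c j₀ j₁)
    from-right ρ@(i , top , plus₁ , (n , topₙ , minusₙ) , only)
      with Finₚ.toℕ-injective (ℕₚ.≤-antisym (partner-previous reasoned ρ c<j₁ x₀≢-∞ j₀<j₁)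
             ([ id , (λ j₁≤n → contradiction (partner-left reasoned (>-wellFounded _) ρ c<j₁) (ℕₚ.≤⇒≯ j₁≤n)) ]′
               (gap n (proj₁ topₙ))))
    ... | refl = i , topₙ , top , inj₂ (ℕₚ.≮⇒≥ j₀≮c , minusₙ , plus₁)
      , λ j j′ tⱼ tⱼ′ pⱼ pⱼ′ → trans (only j tⱼ pⱼ) (sym (only j′ tⱼ′ pⱼ′))

  -- In a common row the plus ends would coincide, or the orientations would put `c` both at or
  -- before `j₀` and after `j₂`.
  segment-row-< : ∀ {c j₀ j₁ j₂ j₃} → Segment x c j₀ j₁ i → Segment x c j₂ j₃ i′ →
                  j₀ Fin.< j₂ → j₂ Fin.< j₃ → j₁ Fin.< j₃ → i Fin.< i′
  segment-row-< {i = i} {i′ = i′} (top₀ , top₁ , sgn , only) (top₂ , top₃ , sgn′ , _) j₀<j₂ j₂<j₃ j₁<j₃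
    with Finₚ.<-cmp i i′
  ... | tri< i<i′ _ _ = i<i′
  ... | tri> _ _ i′<i = contradiction (Top-mono top₂ top₀ i′<i) (ℕₚ.<⇒≱ j₀<j₂)
  ... | tri≈ _ refl _ with sgn | sgn′
  ...   | inj₁ (_ , p₀ , _) | inj₁ (_ , p₂ , _) = contradiction (cong toℕ (only _ _ top₀ top₂ p₀ p₂)) (ℕₚ.<⇒≢ j₀<j₂)
  ...   | inj₁ (_ , p₀ , _) | inj₂ (_ , _ , p₃) =
    contradiction (cong toℕ (only _ _ top₀ top₃ p₀ p₃)) (ℕₚ.<⇒≢ (ℕₚ.<-trans j₀<j₂ j₂<j₃))
  ...   | inj₂ (c≤j₀ , _) | inj₁ (j₂<c , _) = contradiction (ℕₚ.<⇒≤ j₀<j₂) (ℕₚ.<⇒≱ (ℕₚ.<-≤-trans j₂<c c≤j₀))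
  ...   | inj₂ (_ , _ , p₁) | inj₂ (_ , _ , p₃) = contradiction (cong toℕ (only _ _ top₁ top₃ p₁ p₃)) (ℕₚ.<⇒≢ j₁<j₃)

  extreme⇒path : ExtremeGenerator t ε x → ∃ λ P → TropicallyAllowed ε P × Fits P x
  extreme⇒path {x} ext@(x∈K , (j₀ , x₀≢-∞) , _)
    with extreme⇒reasoned ext | enumerate (λ j → finite? (x j))
  ... | c , _ , reasoned | zero , _ , _ , _ , complete = contradiction (proj₁ (complete j₀ x₀≢-∞)) λ ()
  ... | c , _ , reasoned | suc k , J , J-inc , finite , complete
    with choose {Q = λ r → Segment x c (lookup J (inject₁ r)) (lookup J (suc r))} (λ r →
           segment reasoned (finite (inject₁ r)) (finite (suc r)) (J-inc _ _ (inject₁<suc r)) (gap r))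
    where
    gap : ∀ r j → x j ≢ -∞ → j Fin.≤ lookup J (inject₁ r) ⊎ lookup J (suc r) Fin.≤ j
    gap r j xⱼ≢-∞ with complete j xⱼ≢-∞
    ... | s , refl with s Fin.≤? inject₁ r
    ...   | yes s≤r = inj₁ (increasing-mono-≤ J-inc s≤r)
    ...   | no s≰r = inj₂ (increasing-mono-≤ J-inc
                       (subst (λ z → suc z ℕ.≤ toℕ s) (Finₚ.toℕ-inject₁ r) (ℕₚ.≰⇒> s≰r)))
  ... | I , segments = P , ((proj₁ c123 , proj₁ (proj₂ c123) , proj₂ (proj₂ c123) , c4) , c5) , fits
    where
    inject₁-mono-< : ∀ (a b : Fin k) → a Fin.< b → inject₁ a Fin.< inject₁ b
    inject₁-mono-< a b = subst₂ ℕ._<_ (sym (Finₚ.toℕ-inject₁ a)) (sym (Finₚ.toℕ-inject₁ b))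

    P : LatticePath p d
    P = record
      { k = k ; I = I ; J = J ; J-inc = J-inc
      ; I-inc = λ a b a<b → segment-row-< (segments a) (segments b)
          (J-inc _ _ (inject₁-mono-< a b a<b)) (J-inc _ _ (inject₁<suc b)) (J-inc (suc a) (suc b) (s≤s a<b))
      }

    fits : Fits P x
    fits = record
      { support = complete
      ; finite = finite
      ; left = λ r → proj₁ (segments r)
      ; right = λ r → proj₁ (proj₂ (segments r))
      }

    c123 : C1 ε P × C2 ε P × C3 ε P
    c123 = fits⇒C1C2C3 P fits x∈K

    c4 : C4 ε P
    c4 r with proj₁ (proj₂ (proj₂ (segments r)))
    ... | inj₁ (_ , e₀ , e₁) = inj₁ (cong₂ _,_ e₀ e₁)
    ... | inj₂ (_ , e₀ , e₁) = inj₂ (cong₂ _,_ e₀ e₁)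

    c5 : C5 ε P
    c5 r s eq r≤s with proj₁ (proj₂ (proj₂ (segments r))) | proj₁ (proj₂ (proj₂ (segments s)))
    ... | inj₁ (_ , e₀ , _) | _ = contradiction (cong proj₁ eq) (plus≢minus e₀)
    ... | inj₂ _ | inj₂ (_ , e₀ , e₁) = cong₂ _,_ e₀ e₁
    -- Segment `r` begins at or after `c`, and `s` begins no earlier than `r`.
    ... | inj₂ (c≤j , _) | inj₁ (j<c , _) = contradiction
      (ℕₚ.≤-trans c≤j (increasing-mono-≤ J-inc
        (subst₂ ℕ._≤_ (sym (Finₚ.toℕ-inject₁ r)) (sym (Finₚ.toℕ-inject₁ s)) r≤s)))
      (ℕₚ.<⇒≱ j<c)

-- The correspondence between paths and rays.

theorem2 : (ℝ : RealField) → let open Tropical ℝ in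
    (p d : ℕ) → 1 ℕ.≤ p → 1 ℕ.≤ d →
    (t : Fin p → Carrier) → StrictlyIncreasing t →
    (ε : Fin p → Fin d → Sign) →
    ∃ λ (φ : TAPath ε → (Fin d → Rmax)) →
    (∀ P → ExtremeGenerator t ε (φ P))
    × (∀ P Q → SameRay (φ P) (φ Q) → SamePath (proj₁ P) (proj₁ Q))
    × (∀ u → ExtremeGenerator t ε u → ∃ λ P → SameRay (φ P) u)
theorem2 ℝ p d _ _ t t-inc ε =
    (λ P → proj₁ (fitting (proj₁ P)))
  , (λ (P , allowed) → fits⇒extreme P (proj₂ (fitting P)) allowed)
  -- The vector of `Q` is a multiple of that of `P`, so it fits both paths.
  , (λ (P , _) (Q , _) same → fits-unique P Q
      (fits-scale P same (proj₂ (fitting P))) (proj₂ (fitting Q)))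
  , λ u ext → let P , allowed , fits = extreme⇒path ext in
      (P , allowed) , fits⇒sameRay P (proj₂ (fitting P)) fits
  where open Cone ℝ t t-inc ε
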